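{- Let $\mathcal{G}_k$ be the class of triangle-free graphs with circumference at most $k$. Then the chromatic number, the defective chromatic number and the clustered chromatic number of $\mathcal{G}_k$ are each in $\Omega(\sqrt{\log k})$ as $k\to\infty$; that is, there exist an absolute constant $c>0$ and an integer $k_0$ such that for all integers $k\geq k_0$ each of these three numbers is at least $c\sqrt{\log k}$.
   Context: Graphs are finite, simple and undirected. The circumference of a graph that is not a forest is the length of its longest cycle; the circumference of a forest is $2$. A $k$-colouring of a graph assigns one of at most $k$ colours to each vertex (not necessarily properly). A monochromatic component is a connected component of the subgraph induced by all vertices of a single colour. A colouring has defect $d$ if every monochromatic component has maximum degree at most $d$, and has clustering $c$ if every monochromatic component has at most $c$ vertices. For a graph class $\mathcal{G}$: the chromatic number of $\mathcal{G}$ is $\max\{\chi(G):G\in\mathcal{G}\}$, where $\chi(G)$ is the usual (proper) chromatic number; the defective chromatic number of $\mathcal{G}$ is the minimum integer $k$ for which there exists an integer $d$ such that every graph in $\mathcal{G}$ is $k$-colourable with defect $d$; the clustered chromatic number of $\mathcal{G}$ is the minimum integer $k$ for which there exists an integer $c$ such that every graph in $\mathcal{G}$ is $k$-colourable with clustering $c$. (Each is called unbounded if the relevant maximum or minimum does not exist.) -}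

module Defs where

open import Data.Fin using (Fin; zero; suc; inject₁; fromℕ)
open import Data.Fin.Subset using (Subset; _∈_; _∩_; ∣_∣)
open import Data.Integer using () renaming (∣_∣ to abs)
open import Data.Nat using (ℕ; _+_; _*_; _^_; _≤_)
open import Data.Product using (∃; ∃-syntax; Σ-syntax; _×_)
open import Data.Rational using (ℚ; ↥_; ↧ₙ_)
open import Data.Sum using (_⊎_)
open import Data.Vec using (tabulate)
open import Function.Bundles using (_⇔_)
open import Function.Definitions using (Injective)
open import Level using (Level; 0ℓ)
open import Relation.Binary using (Rel; Symmetric; Irreflexive; Decidable)
open import Relation.Binary.Construct.Closure.ReflexiveTransitive using (Star)
open import Relation.Binary.PropositionalEquality using (_≡_; _≢_)
open import Relation.Nullary using (¬_; does)
open import Relation.Unary using (Pred)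

record Graph : Set₁ where
  infix 4 _~_ _~?_
  field
    order    : ℕ
    _~_      : Rel (Fin order) 0ℓ
    ~-sym    : Symmetric _~_
    ~-irrefl : Irreflexive _≡_ _~_
    _~?_     : Decidable _~_

  Vertex : Set
  Vertex = Fin order

  neighbours : Vertex → Subset order
  neighbours u = tabulate (λ v → does (u ~? v))

TriangleFree : Graph → Set
TriangleFree G = ∀ u v w → u ~ v → v ~ w → ¬ (u ~ w)
  where open Graph G

-- A cycle of length 3 + m.
record CycleOf (G : Graph) (m : ℕ) : Set where
  open Graph G
  field
    vertex    : Fin (3 + m) → Vertex
    injective : Injective _≡_ _≡_ vertex
    step      : ∀ (i : Fin (2 + m)) → vertex (inject₁ i) ~ vertex (suc i)
    close     : vertex (fromℕ (2 + m)) ~ vertex zero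

HasCycle : Graph → ℕ → Set
HasCycle G ℓ = ∃[ m ] ℓ ≡ 3 + m × CycleOf G m

Forest : Graph → Set
Forest G = ∀ ℓ → ¬ HasCycle G ℓ

IsCircumference : Graph → ℕ → Set
IsCircumference G c =
  (HasCycle G c × (∀ ℓ → HasCycle G ℓ → ℓ ≤ c)) ⊎ (Forest G × c ≡ 2)

Colouring : Graph → ℕ → Set
Colouring G k = Graph.Vertex G → Fin k

module _ (G : Graph) where
  open Graph G

  InducedAdj : Pred Vertex 0ℓ → Rel Vertex 0ℓ
  InducedAdj P u v = P u × P v × u ~ v

  -- C is the vertex set of a connected component of G[P].
  IsComponent : Pred Vertex 0ℓ → Subset order → Set
  IsComponent P C = ∃[ v ] P v × (∀ u → u ∈ C ⇔ Star (InducedAdj P) v u)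

  IsMonochromaticComponent : ∀ {k} → Colouring G k → Subset order → Set
  IsMonochromaticComponent f C = ∃[ a ] IsComponent (λ v → f v ≡ a) C

  Proper : ∀ {k} → Colouring G k → Set
  Proper f = ∀ u v → u ~ v → f u ≢ f v

  -- Components are induced subgraphs, so the degree of u in C is the number
  -- of its neighbours lying in C.
  HasDefect : ∀ {k} → ℕ → Colouring G k → Set
  HasDefect d f = ∀ C → IsMonochromaticComponent f C →
                  ∀ u → u ∈ C → ∣ neighbours u ∩ C ∣ ≤ d

  HasClustering : ∀ {k} → ℕ → Colouring G k → Set
  HasClustering c f = ∀ C → IsMonochromaticComponent f C → ∣ C ∣ ≤ c

private variable ℓ : Level

IsMinimum : Pred ℕ ℓ → Pred ℕ ℓ
IsMinimum P n = P n × (∀ m → P m → n ≤ m)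

IsMaximum : Pred ℕ ℓ → Pred ℕ ℓ
IsMaximum P n = P n × (∀ m → P m → m ≤ n)

Isχ : Graph → ℕ → Set
Isχ G = IsMinimum (λ k → Σ[ f ∈ Colouring G k ] Proper G f)

GraphClass : Set₁
GraphClass = Pred Graph 0ℓ

-- The three parameters of a class are partial, hence relations to ℕ; a class
-- on which a parameter is unbounded is related to no n.

IsChromaticNumber : GraphClass → ℕ → Set₁
IsChromaticNumber 𝒢 = IsMaximum (λ n → ∃[ G ] 𝒢 G × Isχ G n)

IsDefectiveChromaticNumber : GraphClass → ℕ → Set₁
IsDefectiveChromaticNumber 𝒢 =
  IsMinimum (λ k → ∃[ d ] ∀ G → 𝒢 G → Σ[ f ∈ Colouring G k ] HasDefect G d f)

IsClusteredChromaticNumber : GraphClass → ℕ → Set₁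
IsClusteredChromaticNumber 𝒢 =
  IsMinimum (λ k → ∃[ c ] ∀ G → 𝒢 G → Σ[ f ∈ Colouring G k ] HasClustering G c f)

TriangleFreeWithCircumference≤ : ℕ → GraphClass
TriangleFreeWithCircumference≤ k G =
  TriangleFree G × (∃[ c ] IsCircumference G c × c ≤ k)

-- For c = p/q > 0 and k ≥ 1, the inequality n ≥ c √(log₂ k) between real
-- numbers says (q n)² ≥ p² log₂ k, that is k ^ p² ≤ 2 ^ (q n)².  The base of
-- the logarithm only affects the constant c, and a positive real constant can
-- always be decreased to a positive rational one.
infix 4 _≥_√log_
_≥_√log_ : ℕ → ℚ → ℕ → Set
n ≥ c √log k = k ^ (abs (↥ c) ^ 2) ≤ 2 ^ ((↧ₙ c * n) ^ 2)

-- A parameter is at least c √(log k) if its value, when it has one, is;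
-- an unbounded parameter is at least every number.
_AtLeast_√log_ : Pred ℕ ℓ → ℚ → ℕ → Set ℓ
IsValue AtLeast c √log k = ∀ n → IsValue n → n ≥ c √log k

{-# OPTIONS --safe #-}

-- Consider the game in which the vertices of a triangle-free graph are
-- presented one at a time, each with its edges to the earlier ones, and are
-- properly coloured with s colours as they arrive.  A new vertex is joined to
-- an independent set with at most one vertex of each colour, chosen greedily
-- from the most recent vertex backwards.  A vertex x of a colour c is passed
-- over only because another c is taken or because x is joined to some chosen,
-- more recent y; each such y has at most one neighbour of colour c, and there
-- is at most one y of each colour.  So every colour with more than s vertices
-- is represented in the chosen set and cannot be used again, and the game
-- ends within s (s + 1) vertices.
--
-- The tree of all plays, with each move repeated many times, is a single
-- triangle-free graph: with defect d, each vertex spoils at most d of the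
-- copies of a move, so some branch of the tree is a proper play longer than
-- the game allows.  All edges join a word to one of its suffixes, so a path
-- has fewer than 2 ^ (1 + depth) vertices, where the depth is s (s + 1) + 1.
-- The inequality to be proved is decidable, so the argument may be classical.

module Submission where

open import Defs
open import Data.Empty using (⊥; ⊥-elim)
open import Data.Fin as Fin using (Fin; zero; suc; inject₁; combine; remQuot)
import Data.Fin.Properties as Fin
open import Data.Fin.Subset as Subset using (Subset; _∩_; ∣_∣)
import Data.Fin.Subset.Properties as Subset
open import Data.List using (List; []; _∷_; _++_; length; map; tabulate; allFin)
open import Data.List.Membership.Propositional using (_∈_; _∉_)
open import Data.List.Membership.Propositional.Properties using (∈-++⁺ˡ; ∈-++⁺ʳ; ∈-++⁻; ∈-allFin)
import Data.List.Membership.DecPropositional as DecMembership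
open import Data.List.Properties using (≡-dec; length-map; length-tabulate; length-++)
open import Data.List.Relation.Binary.Sublist.Propositional using (_⊆_; []; _∷_; _∷ʳ_)
open import Data.List.Relation.Binary.Sublist.Propositional.Properties using (All-resp-⊆)
open import Data.List.Relation.Unary.All as All using (All; []; _∷_)
import Data.List.Relation.Unary.All.Properties as All
open import Data.List.Relation.Unary.AllPairs as AllPairs using (AllPairs; []; _∷_)
import Data.List.Relation.Unary.AllPairs.Properties as AllPairs
open import Data.List.Relation.Unary.Any using (here; there)
open import Data.List.Relation.Unary.Linked as Linked using (Linked; []; [-]; _∷_)
open import Data.List.Relation.Unary.Unique.Propositional using (Unique)
open import Data.Nat
open import Data.Nat.Properties
open import Data.Nat.Tactic.RingSolver using (solve-∀)
open import Data.Product using (∃-syntax; Σ-syntax; _×_; _,_; proj₁; proj₂)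
open import Data.Product.Properties using () renaming (≡-dec to ×-≡-dec)
open import Data.Rational using (ℚ; Positive; ½)
open import Data.Sum as Sum using (_⊎_; inj₁; inj₂; swap)
open import Data.Vec as Vec using ()
open import Data.Vec.Properties using (lookup∘tabulate; lookup⇒[]=; []=⇒lookup)
open import Effect.Monad using (RawMonad)
open import Function using (_∘_; id; _⇔_; mk⇔; Equivalence)
open import Level using (Level; 0ℓ)
open import Relation.Binary using (Rel; DecidableEquality)
open import Relation.Binary.Construct.Closure.ReflexiveTransitive using (Star; ε; _◅_)
open import Relation.Binary.PropositionalEquality hiding ([_])
open import Relation.Nullary
open import Relation.Nullary.Decidable
  using (map′; _⊎-dec_; _×-dec_; dec-true; decidable-stable; ¬¬-excluded-middle)
open import Relation.Nullary.Negation using (¬¬-Monad)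
open import Relation.Unary using (Pred)

private variable
  A B : Set
  p : Level

-- The suffix order on words

infix 4 _≼_ _≺_

data _≼_ {A : Set} (u : List A) : List A → Set where
  ≼-refl  : u ≼ u
  ≼-there : ∀ {a v} → u ≼ v → u ≼ a ∷ v

_≺_ : {A : Set} → Rel (List A) 0ℓ
u ≺ v = ∃[ a ] a ∷ u ≼ v

≼-trans : {u v w : List A} → u ≼ v → v ≼ w → u ≼ w
≼-trans u≼v ≼-refl        = u≼v
≼-trans u≼v (≼-there v≼w) = ≼-there (≼-trans u≼v v≼w)

≼-tail : ∀ {a} {u v : List A} → a ∷ u ≼ v → u ≼ v
≼-tail = ≼-trans (≼-there ≼-refl)

≼-length : {u v : List A} → u ≼ v → length u ≤ length v
≼-length ≼-refl        = ≤-refl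
≼-length (≼-there u≼v) = m≤n⇒m≤1+n (≼-length u≼v)

≼-irrefl : ∀ {a} {u : List A} → ¬ a ∷ u ≼ u
≼-irrefl = 1+n≰n ∘ ≼-length

≼-total : {u v w : List A} → u ≼ w → v ≼ w → u ≼ v ⊎ v ≼ u
≼-total ≼-refl        v≼w           = inj₂ v≼w
≼-total (≼-there u≼w) ≼-refl        = inj₁ (≼-there u≼w)
≼-total (≼-there u≼w) (≼-there v≼w) = ≼-total u≼w v≼w

-- Both are suffixes of `w` of the same length, so neither is a proper suffix of the other.
≼-head : ∀ {a b} {u w : List A} → a ∷ u ≼ w → b ∷ u ≼ w → a ≡ b
≼-head p q with ≼-total p q
... | inj₁ ≼-refl      = refl
... | inj₁ (≼-there r) = ⊥-elim (≼-irrefl r)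
... | inj₂ ≼-refl      = refl
... | inj₂ (≼-there r) = ⊥-elim (≼-irrefl r)

≼-map : (f : A → B) {u v : List A} → u ≼ v → map f u ≼ map f v
≼-map f ≼-refl        = ≼-refl
≼-map f (≼-there u≼v) = ≼-there (≼-map f u≼v)

≼-unmap : (f : A → B) {h : List B} (v : List A) → h ≼ map f v → ∃[ u ] u ≼ v × map f u ≡ h
≼-unmap f []      ≼-refl      = [] , ≼-refl , refl
≼-unmap f (a ∷ v) ≼-refl      = a ∷ v , ≼-refl , refl
≼-unmap f (_ ∷ v) (≼-there p) with u , u≼v , eq ← ≼-unmap f v p = u , ≼-there u≼v , eq

≼⇒≡⊎≺ : {u v : List A} → u ≼ v → u ≡ v ⊎ u ≺ v
≼⇒≡⊎≺ ≼-refl = inj₁ refl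
≼⇒≡⊎≺ (≼-there {a} p) with ≼⇒≡⊎≺ p
... | inj₁ refl    = inj₂ (a , ≼-refl)
... | inj₂ (b , q) = inj₂ (b , ≼-there q)

≼-dec : DecidableEquality A → (u v : List A) → Dec (u ≼ v)
≼-dec _≟_ u [] with ≡-dec _≟_ u []
... | yes refl = yes ≼-refl
... | no  u≢[] = no λ { ≼-refl → u≢[] refl }
≼-dec _≟_ u (b ∷ v) with ≡-dec _≟_ u (b ∷ v)
... | yes refl = yes ≼-refl
... | no  u≢bv = map′ ≼-there (λ { ≼-refl → ⊥-elim (u≢bv refl) ; (≼-there p) → p }) (≼-dec _≟_ u v)

suffixes : List A → List (List A)
suffixes []      = []
suffixes (_ ∷ h) = h ∷ suffixes h

length-suffixes : (h : List A) → length (suffixes h) ≡ length h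
length-suffixes []      = refl
length-suffixes (_ ∷ h) = cong suc (length-suffixes h)

All-suffixes : (h : List A) → All (_≺ h) (suffixes h)
All-suffixes []      = []
All-suffixes (a ∷ h) = (a , ≼-refl) ∷ All.map (λ (b , p) → b , ≼-there p) (All-suffixes h)

AllPairs-suffixes : (h : List A) → AllPairs (λ x y → y ≺ x) (suffixes h)
AllPairs-suffixes []      = []
AllPairs-suffixes (_ ∷ h) = All-suffixes h ∷ AllPairs-suffixes h

≺⇒∈suffixes : {u : List A} (v : List A) → u ≺ v → u ∈ suffixes v
≺⇒∈suffixes (_ ∷ v) (_ , ≼-refl)    = here refl
≺⇒∈suffixes (_ ∷ v) (a , ≼-there p) = there (≺⇒∈suffixes v (a , p))

-- Sublists and a pigeonhole principle

AllPairs-resp-⊆ : {R : Rel A 0ℓ} {xs ys : List A} → xs ⊆ ys → AllPairs R ys → AllPairs R xs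
AllPairs-resp-⊆ []          []         = []
AllPairs-resp-⊆ (_ ∷ʳ τ)    (_ ∷ pys)  = AllPairs-resp-⊆ τ pys
AllPairs-resp-⊆ (refl ∷ τ)  (py ∷ pys) = All-resp-⊆ τ py ∷ AllPairs-resp-⊆ τ pys

All-⊎-split : {P Q : Pred A 0ℓ} {xs : List A} → All (λ x → P x ⊎ Q x) xs →
  ∃[ ys ] ∃[ zs ] ys ⊆ xs × zs ⊆ xs × All P ys × All Q zs × length xs ≡ length ys + length zs
All-⊎-split [] = [] , [] , [] , [] , [] , [] , refl
All-⊎-split (_∷_ {x} pq pqs) with ys , zs , τ , υ , ps , qs , eq ← All-⊎-split pqs with pq
... | inj₁ p = x ∷ ys , zs , refl ∷ τ , x ∷ʳ υ , p ∷ ps , qs , cong suc eq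
... | inj₂ q = ys , x ∷ zs , x ∷ʳ τ , refl ∷ υ , ps , q ∷ qs ,
               trans (cong suc eq) (sym (+-suc (length ys) (length zs)))

-- Classes are peeled off one at a time. `R` passes to sublists, so `bound` may rely on the entries
-- of a class being ordered or distinct.
pigeonhole-AllPairs : {R : Rel A 0ℓ} (P : B → Pred A 0ℓ) (d : ℕ) (bs : List B) {xs : List A} →
  AllPairs R xs →
  (∀ b ys → AllPairs R ys → All (P b) ys → length ys ≤ d) →
  All (λ x → ∃[ b ] b ∈ bs × P b x) xs →
  length xs ≤ length bs * d
pigeonhole-AllPairs P d []       _  _     []                 = z≤n
pigeonhole-AllPairs P d []       _  _     ((_ , () , _) ∷ _)
pigeonhole-AllPairs P d (b ∷ bs) Rxs bound Pxs
  with ys , zs , τ , υ , Pys , Pzs , eq ← All-⊎-split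
         (All.map (λ { (_ , here refl , p) → inj₁ p ; (c , there c∈ , p) → inj₂ (c , c∈ , p) }) Pxs)
  = ≤-trans (≤-reflexive eq)
      (+-mono-≤ (bound b ys (AllPairs-resp-⊆ τ Rxs) Pys)
                (pigeonhole-AllPairs P d bs (AllPairs-resp-⊆ υ Rxs) bound Pzs))

-- The greedy strategy and the length of a proper play

module Strategy {C : Set} (_≟_ : DecidableEquality C) where

  open DecMembership _≟_ using (_∈?_)
  open DecMembership (≡-dec _≟_) using () renaming (_∈?_ to _∈ʰ?_)

  -- A history lists the colours of the vertices presented so far, newest
  -- first.  Its suffix c ∷ x stands for the vertex presented at the history x
  -- and then coloured c, and back h is the set joined to the vertex presented
  -- at the history h.
  select : List C → List C → List (List C) → List (List C)
  back   : List C → List (List C)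
  back h = select h [] []

  select []      used blocked = []
  select (c ∷ h) used blocked with (c ∈? used) ⊎-dec ((c ∷ h) ∈ʰ? blocked)
  ... | yes _ = select h used blocked
  ... | no  _ = (c ∷ h) ∷ select h (c ∷ used) (select h [] [] ++ blocked)

  select-≼ : ∀ h {used blocked e} → e ∈ select h used blocked → e ≼ h
  select-≼ (c ∷ h) {used} {blocked} e∈ with (c ∈? used) ⊎-dec ((c ∷ h) ∈ʰ? blocked) | e∈
  ... | yes _ | e∈′       = ≼-there (select-≼ h e∈′)
  ... | no  _ | here refl = ≼-refl
  ... | no  _ | there e∈′ = ≼-there (select-≼ h e∈′)

  select-unused : ∀ h {used blocked d y} → d ∷ y ∈ select h used blocked → d ∉ used
  select-unused (c ∷ h) {used} {blocked} e∈ with (c ∈? used) ⊎-dec ((c ∷ h) ∈ʰ? blocked) | e∈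
  ... | yes _ | e∈′       = select-unused h e∈′
  ... | no ¬p | here refl = ¬p ∘ inj₁
  ... | no  _ | there e∈′ = select-unused h e∈′ ∘ there

  select-unblocked : ∀ h {used blocked e} → e ∈ select h used blocked → e ∉ blocked
  select-unblocked (c ∷ h) {used} {blocked} e∈ with (c ∈? used) ⊎-dec ((c ∷ h) ∈ʰ? blocked) | e∈
  ... | yes _ | e∈′       = select-unblocked h e∈′
  ... | no ¬p | here refl = ¬p ∘ inj₂
  ... | no  _ | there e∈′ = select-unblocked h e∈′ ∘ ∈-++⁺ʳ (back h)

  back-≼ : ∀ {h e} → e ∈ back h → e ≼ h
  back-≼ {h} = select-≼ h

  -- Choosing a vertex blocks its back-neighbours from then on, and `back y` reaches only vertices
  -- older than `d ∷ y`.
  select-independent : ∀ h {used blocked d y e} →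
    d ∷ y ∈ select h used blocked → e ∈ select h used blocked → e ∉ back y
  select-independent (c ∷ h) {used} {blocked} p q e∈y
    with (c ∈? used) ⊎-dec ((c ∷ h) ∈ʰ? blocked) | p | q
  ... | yes _ | p′        | q′        = select-independent h p′ q′ e∈y
  ... | no  _ | here refl | here refl = ≼-irrefl (back-≼ e∈y)
  ... | no  _ | here refl | there q′  = select-unblocked h q′ (∈-++⁺ˡ e∈y)
  ... | no  _ | there p′  | here refl =
    ≼-irrefl (≼-trans (≼-trans (back-≼ e∈y) (≼-there ≼-refl)) (select-≼ h p′))
  ... | no  _ | there p′  | there q′  = select-independent h p′ q′ e∈y

  select-colours : ∀ h {used blocked c x y} →
    c ∷ x ∈ select h used blocked → c ∷ y ∈ select h used blocked → x ≡ y
  select-colours (c ∷ h) {used} {blocked} p q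
    with (c ∈? used) ⊎-dec ((c ∷ h) ∈ʰ? blocked) | p | q
  ... | yes _ | p′        | q′        = select-colours h p′ q′
  ... | no  _ | here refl | here refl = refl
  ... | no  _ | here refl | there q′  = ⊥-elim (select-unused h q′ (here refl))
  ... | no  _ | there p′  | here refl = ⊥-elim (select-unused h p′ (here refl))
  ... | no  _ | there p′  | there q′  = select-colours h p′ q′

  -- As no vertex of colour `c` is chosen, `c` never enters the used colours. So `c ∷ x` is passed
  -- over for being blocked, from the outset or as a back-neighbour of a chosen vertex.
  select-covers : ∀ h {used blocked c} → c ∉ used →
    (∀ x → c ∷ x ∉ select h used blocked) → ∀ {x} → c ∷ x ≼ h →
    c ∷ x ∈ blocked ⊎ ∃[ d ] ∃[ y ] d ∷ y ∈ select h used blocked × c ∷ x ∈ back y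
  select-covers (c′ ∷ h) {used} {blocked} c∉ none x≼
    with (c′ ∈? used) ⊎-dec ((c′ ∷ h) ∈ʰ? blocked) | none | x≼
  ... | yes (inj₁ c∈)  | _     | ≼-refl    = ⊥-elim (c∉ c∈)
  ... | yes (inj₂ ch∈) | _     | ≼-refl    = inj₁ ch∈
  ... | yes _          | none′ | ≼-there p = select-covers h c∉ none′ p
  ... | no _           | none′ | ≼-refl    = ⊥-elim (none′ h (here refl))
  ... | no _           | none′ | ≼-there p with select-covers h
          (λ { (here refl) → none′ h (here refl) ; (there c∈) → c∉ c∈ }) (λ x → none′ x ∘ there) p
  ... | inj₂ (d , y , dy∈ , cx∈) = inj₂ (d , y , there dy∈ , cx∈)
  ... | inj₁ cx∈ with ∈-++⁻ (back h) cx∈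
  ... | inj₁ cx∈h = inj₂ (c′ , h , here refl , cx∈h)
  ... | inj₂ cx∈b = inj₁ cx∈b

  ProperHistory : List C → Set
  ProperHistory h = ∀ {c x} → c ∷ x ≼ h → ∀ y → c ∷ y ∉ back x

  -- The newest of these vertices is presented at the head `x`. Properness keeps `c` out of
  -- `back x`, so each other one is joined to a chosen blocker; the pigeonhole runs over the colours
  -- of the blockers.
  colour-class-bound : ∀ (cs : List C) → (∀ c → c ∈ cs) → ∀ {h} → ProperHistory h →
    ∀ c ys → AllPairs (λ x y → y ≺ x) ys → All (λ y → c ∷ y ≼ h) ys →
    length ys ≤ suc (length cs)
  colour-class-bound cs complete proper c []       _          _          = z≤n
  colour-class-bound cs complete {h} proper c (x ∷ ys) (ys≺x ∷ R) (cx≼h ∷ cys≼h) =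
    s≤s (subst (length ys ≤_) (*-identityʳ (length cs))
      (pigeonhole-AllPairs Blocks 1 cs R unique-blocked
        (All.zipWith blocker (ys≺x , cys≼h))))
    where
    Blocks : C → List C → Set
    Blocks d y = ∃[ z ] d ∷ z ∈ back x × c ∷ y ∈ back z
    unique-blocked : ∀ d zs → AllPairs (λ x y → y ≺ x) zs → All (Blocks d) zs → length zs ≤ 1
    unique-blocked d []           _ _ = z≤n
    unique-blocked d (_ ∷ [])     _ _ = ≤-refl
    unique-blocked d (_ ∷ _ ∷ _) (((_ , p) ∷ _) ∷ _) ((z , dz∈ , c∈) ∷ (z′ , dz′∈ , c′∈) ∷ _)
      with refl ← select-colours x dz∈ dz′∈ with refl ← select-colours z c∈ c′∈ = ⊥-elim (≼-irrefl p)
    blocker : ∀ {y} → (y ≺ x × c ∷ y ≼ h) → ∃[ d ] d ∈ cs × Blocks d y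
    blocker ((d , dy≼x) , cy≼h)
      -- The order gives some letter `d` after `y`; it is `c`, since `h` determines it.
      with refl ← ≼-head cy≼h (≼-trans dy≼x (≼-tail cx≼h))
      with select-covers x (λ ()) (proper cx≼h) dy≼x
    ... | inj₂ (d , z , dz∈ , cy∈) = d , complete d , z , dz∈ , cy∈

  proper-history-bound : ∀ (cs : List C) → (∀ c → c ∈ cs) → ∀ {h} → ProperHistory h →
    length h ≤ length cs * suc (length cs)
  proper-history-bound cs complete {h} proper =
    subst (_≤ _) (length-suffixes h)
      (pigeonhole-AllPairs (λ c y → c ∷ y ≼ h) _ cs (AllPairs-suffixes h)
        (colour-class-bound cs complete proper)
        (All.map (λ (c , p) → c , complete c , p) (All-suffixes h)))

-- Paths in the suffix order

IsPath : List (List A) → Set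
IsPath xs = Unique xs × Linked (λ u v → u ≼ v ⊎ v ≼ u) xs

IsPath-++⁻ : (xs : List (List A)) {ys : List (List A)} →
  IsPath (xs ++ ys) → IsPath xs × IsPath ys
IsPath-++⁻ [] p = ([] , []) , p
IsPath-++⁻ (x ∷ []) (_ ∷ uniq , linked) = ([] ∷ [] , [-]) , uniq , Linked.tail linked
IsPath-++⁻ (x ∷ x′ ∷ xs) (x∉ ∷ uniq , comparable ∷ linked)
  with (uniq′ , linked′) , pys ← IsPath-++⁻ (x′ ∷ xs) (uniq , linked) =
  (All.++⁻ˡ (x′ ∷ xs) x∉ ∷ uniq′ , comparable ∷ linked′) , pys

split-at-root : (r : List A) {xs : List (List A)} → Unique xs → All (r ≼_) xs →
  All (r ≺_) xs ⊎ ∃[ ys ] ∃[ zs ] xs ≡ ys ++ r ∷ zs × All (r ≺_) ys × All (r ≺_) zs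
split-at-root r []          [] = inj₁ []
split-at-root r (x∉ ∷ uniq) (r≼x ∷ r≼xs) with ≼⇒≡⊎≺ r≼x
... | inj₁ refl = inj₂ ([] , _ , refl , [] , All.zipWith strict (x∉ , r≼xs))
  where
  strict : ∀ {y} → (r ≢ y × r ≼ y) → r ≺ y
  strict (r≢y , r≼y) with ≼⇒≡⊎≺ r≼y
  ... | inj₁ r≡y = ⊥-elim (r≢y r≡y)
  ... | inj₂ r≺y = r≺y
... | inj₂ r≺x with split-at-root r uniq r≼xs
... | inj₁ r≺xs = inj₁ (r≺x ∷ r≺xs)
... | inj₂ (ys , zs , refl , r≺ys , r≺zs) = inj₂ (_ ∷ ys , zs , refl , r≺x ∷ r≺ys , r≺zs)

-- Passing between comparable words above `r` cannot change the letter after `r`, as the shorter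
-- word already contains it.
common-child : ∀ {a} {r x : List A} {xs} → Linked (λ u v → u ≼ v ⊎ v ≼ u) (x ∷ xs) →
  a ∷ r ≼ x → All (r ≺_) xs → All (a ∷ r ≼_) xs
common-child [-] _ [] = []
common-child (inj₁ x≼y ∷ linked) ar≼x (_ ∷ r≺xs) =
  ≼-trans ar≼x x≼y ∷ common-child linked (≼-trans ar≼x x≼y) r≺xs
common-child (inj₂ y≼x ∷ linked) ar≼x ((_ , br≼y) ∷ r≺xs)
  with refl ← ≼-head ar≼x (≼-trans br≼y y≼x) = br≼y ∷ common-child linked br≼y r≺xs

mutual
  -- Here `n` is the height left above `r`. A path meets `r` at most once, and each piece around it
  -- stays above a single child of `r`, so the maximal lengths satisfy L(n+1) ≤ 2 L(n) + 1.
  path-length-≼ : ∀ n (r : List A) {xs} → IsPath xs → All (r ≼_) xs →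
    All (λ x → length x ≤ n + length r) xs → length xs < 2 ^ suc n
  path-length-≼ n r {xs} p@(uniq , _) r≼xs short with split-at-root r uniq r≼xs
  ... | inj₁ r≺xs = <-≤-trans (path-length-≺ n r p r≺xs short) (m≤m+n (2 ^ n) _)
  ... | inj₂ (ys , zs , refl , r≺ys , r≺zs)
    with pys , uniq′ , linked′ ← IsPath-++⁻ ys p
    with short-ys , _ ∷ short-zs ← All.++⁻ ys short = begin-strict
    length (ys ++ r ∷ zs)         ≡⟨ length-++ ys ⟩
    length ys + suc (length zs)   <⟨ +-mono-<-≤
      (path-length-≺ n r pys r≺ys short-ys)
      (path-length-≺ n r (AllPairs.tail uniq′ , Linked.tail linked′) r≺zs short-zs) ⟩
    2 ^ n + 2 ^ n                 ≡⟨ cong (2 ^ n +_) (+-identityʳ (2 ^ n)) ⟨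
    2 ^ suc n                     ∎
    where open ≤-Reasoning

  path-length-≺ : ∀ n (r : List A) {xs} → IsPath xs → All (r ≺_) xs →
    All (λ x → length x ≤ n + length r) xs → length xs < 2 ^ n
  path-length-≺ n       r p [] _ = m^n>0 2 n
  path-length-≺ zero    r p ((_ , ar≼x) ∷ _) (short ∷ _) =
    ⊥-elim (<⇒≱ (≼-length ar≼x) short)
  path-length-≺ (suc n) r p@(_ , linked) ((a , ar≼x) ∷ r≺xs) short =
    path-length-≼ n (a ∷ r) p (ar≼x ∷ common-child linked ar≼x r≺xs)
      (All.map (λ {x} → subst (length x ≤_) (sym (+-suc n (length r)))) short)

Linked-tabulate : {R : Rel A 0ℓ} (n : ℕ) (f : Fin (suc n) → A) →
  (∀ i → R (f (inject₁ i)) (f (suc i))) → Linked R (tabulate f)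
Linked-tabulate zero    f step = [-]
Linked-tabulate (suc n) f step = step zero ∷ Linked-tabulate n (f ∘ suc) (step ∘ suc)

-- The common consequence of properness, bounded defect and bounded clustering on which the argument
-- rests, phrased without components.
FewMonochromaticNeighbours : (G : Graph) → ∀ {k} → ℕ → Colouring G k → Set
FewMonochromaticNeighbours G d f =
  ∀ u ys → Unique ys → All (λ y → Graph._~_ G u y × f u ≡ f y) ys → length ys ≤ d

-- The tree of plays as a triangle-free graph

-- A letter (c , i) on top of the word v names the i-th child of v, for
-- colourings giving v the colour c.
module GameTree (s N t : ℕ) where

  open Strategy {Fin s} Fin._≟_
  open DecMembership (≡-dec (Fin._≟_ {s})) using (_∈?_)

  Letter Word : Set
  Letter = Fin s × Fin N
  Word   = List Letter

  history : Word → List (Fin s)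
  history = map proj₁

  -- On the branch to `v` the letter `a` after `u` gives the colour of `u`, so `history (a ∷ u)`
  -- stands for `u` in that play.
  Edge : Rel Word 0ℓ
  Edge u v = ∃[ a ] a ∷ u ≼ v × history (a ∷ u) ∈ back (history v)

  edge? : ∀ u v → Dec (Edge u v)
  edge? u v = map′ (λ (c , i , e) → (c , i) , e) (λ ((c , i) , e) → c , i , e)
    (Fin.any? λ c → Fin.any? λ i →
      ≼-dec (×-≡-dec Fin._≟_ Fin._≟_) ((c , i) ∷ u) v ×-dec
      (history ((c , i) ∷ u) ∈? back (history v)))

  edge⇒≺ : ∀ {u v} → Edge u v → u ≺ v
  edge⇒≺ (a , au≼v , _) = a , au≼v

  edge-asym : ∀ {u v} → Edge u v → ¬ v ≼ u
  edge-asym (_ , au≼v , _) v≼u = ≼-irrefl (≼-trans au≼v v≼u)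

  edge-≼-trans : ∀ {u v w} → Edge u v → Edge v w → u ≼ w
  edge-≼-trans (_ , au≼v , _) (_ , bv≼w , _) = ≼-trans (≼-tail au≼v) (≼-tail bv≼w)

  -- The letter after `u` is the same on the way to `v` and to `w`, so `u` and `v` both give members
  -- of the independent set chosen for `w`.
  no-transitive-edge : ∀ {u v w} → Edge u v → Edge v w → ¬ Edge u w
  no-transitive-edge {v = v} {w} (a , au≼v , au∈) (b , bv≼w , bv∈) (a′ , a′u≼w , a′u∈)
    with refl ← ≼-head a′u≼w (≼-trans au≼v (≼-tail bv≼w)) =
    select-independent (history w) bv∈ a′u∈ au∈

  size : ℕ → ℕ
  size zero    = 1
  size (suc n) = suc (s * N * size n)

  decode : ∀ n → Fin (size n) → Word
  decode zero    _       = []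
  decode (suc n) zero    = []
  decode (suc n) (suc x) with a , y ← remQuot {s * N} (size n) x = remQuot {s} N a ∷ decode n y

  -- Words of length more than n are truncated.
  encode : ∀ n → Word → Fin (size n)
  encode zero    _             = zero
  encode (suc n) []            = zero
  encode (suc n) ((c , i) ∷ w) = suc (combine (combine c i) (encode n w))

  decode-encode : ∀ n w → length w ≤ n → decode n (encode n w) ≡ w
  decode-encode zero    []            _       = refl
  decode-encode (suc n) []            _       = refl
  decode-encode (suc n) ((c , i) ∷ w) (s≤s p)
    = cong₂ _∷_
        (trans (cong (remQuot {s} N ∘ proj₁) split) (Fin.remQuot-combine c i))
        (trans (cong (decode n ∘ proj₂) split) (decode-encode n w p))
    where
    split : remQuot (size n) (combine (combine c i) (encode n w)) ≡ (combine c i , encode n w)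
    split = Fin.remQuot-combine (combine c i) (encode n w)

  encode-decode : ∀ n x → encode n (decode n x) ≡ x
  encode-decode zero    zero    = refl
  encode-decode (suc n) zero    = refl
  encode-decode (suc n) (suc x) = cong suc (trans
    (cong₂ combine (Fin.combine-remQuot {s} N a) (encode-decode n y))
    (Fin.combine-remQuot {s * N} (size n) x))
    where
    a = proj₁ (remQuot {s * N} (size n) x)
    y = proj₂ (remQuot {s * N} (size n) x)

  decode-length : ∀ n x → length (decode n x) ≤ n
  decode-length zero    _       = z≤n
  decode-length (suc n) zero    = z≤n
  decode-length (suc n) (suc i) = s≤s (decode-length n (proj₂ (remQuot {s * N} (size n) i)))

  graph : Graph
  graph = record
    { order    = size t
    ; _~_      = λ x y → Edge (decode t x) (decode t y) ⊎ Edge (decode t y) (decode t x)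
    ; ~-sym    = swap
    ; ~-irrefl = λ { refl (inj₁ e) → edge-asym e ≼-refl ; refl (inj₂ e) → edge-asym e ≼-refl }
    ; _~?_     = λ x y → edge? (decode t x) (decode t y) ⊎-dec edge? (decode t y) (decode t x)
    }

  -- Orient each edge towards the longer word: six of the eight cases are transitive triangles, the
  -- other two directed cycles.
  graph-triangle-free : TriangleFree graph
  graph-triangle-free _ _ _ (inj₁ uv) (inj₁ vw) (inj₁ uw) = no-transitive-edge uv vw uw
  graph-triangle-free _ _ _ (inj₁ uv) (inj₁ vw) (inj₂ wu) = edge-asym wu (edge-≼-trans uv vw)
  graph-triangle-free _ _ _ (inj₁ uv) (inj₂ wv) (inj₁ uw) = no-transitive-edge uw wv uv
  graph-triangle-free _ _ _ (inj₁ uv) (inj₂ wv) (inj₂ wu) = no-transitive-edge wu uv wv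
  graph-triangle-free _ _ _ (inj₂ vu) (inj₁ vw) (inj₁ uw) = no-transitive-edge vu uw vw
  graph-triangle-free _ _ _ (inj₂ vu) (inj₁ vw) (inj₂ wu) = no-transitive-edge vw wu vu
  graph-triangle-free _ _ _ (inj₂ vu) (inj₂ wv) (inj₁ uw) = edge-asym uw (edge-≼-trans wv vu)
  graph-triangle-free _ _ _ (inj₂ vu) (inj₂ wv) (inj₂ wu) = no-transitive-edge wv vu wu

  -- Without its closing edge the cycle is a path in the suffix order above `[]`.
  graph-cycle-length : ∀ ℓ → HasCycle graph ℓ → ℓ < 2 ^ suc t
  graph-cycle-length _ (m , refl , cycle) =
    subst (_< 2 ^ suc t) (length-tabulate word)
      (path-length-≼ t [] (distinct , Linked-tabulate (2 + m) word comparable)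
        (All.tabulate⁺ {f = word} ([]-≼ ∘ word))
        (All.tabulate⁺ {f = word} λ i →
          ≤-trans (decode-length t (vertex i)) (≤-reflexive (sym (+-identityʳ t)))))
    where
    open CycleOf cycle
    word : Fin (3 + m) → Word
    word = decode t ∘ vertex
    []-≼ : (w : Word) → [] ≼ w
    []-≼ []      = ≼-refl
    []-≼ (_ ∷ w) = ≼-there ([]-≼ w)
    distinct : Unique (tabulate word)
    distinct = AllPairs.tabulate⁺ λ {i} {j} i≢j eq → i≢j (injective
      (trans (sym (encode-decode t (vertex i))) (trans (cong (encode t) eq) (encode-decode t (vertex j)))))
    comparable : ∀ i → word (inject₁ i) ≼ word (suc i) ⊎ word (suc i) ≼ word (inject₁ i)
    comparable i = Sum.map (≼-tail ∘ proj₂ ∘ edge⇒≺) (≼-tail ∘ proj₂ ∘ edge⇒≺) (step i)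

  -- A long proper play in a coloured tree

  module _ {d : ℕ} (enough-copies : t * d < N) (deep : s * suc s < t)
           (f : Colouring graph s) (few : FewMonochromaticNeighbours graph d f) where

    colour : Word → Fin s
    colour = f ∘ encode t

    Faithful Proper-along : Word → Set
    Faithful v     = ∀ {a x} → a ∷ x ≼ v → proj₁ a ≡ colour x
    Proper-along v = ∀ {x u} → u ≼ v → Edge x u → colour x ≢ colour u

    faithful-history-proper : ∀ v → Faithful v → Proper-along v → ProperHistory (history v)
    faithful-history-proper v faithful proper cx≼ y cy∈
      with a ∷ x′ , ax′≼v , refl ← ≼-unmap proj₁ v cx≼
      with b ∷ y′ , by′≼x′ , refl ← ≼-unmap proj₁ x′ (back-≼ cy∈) =
      proper (≼-tail ax′≼v) (b , by′≼x′ , cy∈)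
        (trans (sym (faithful (≼-trans by′≼x′ (≼-tail ax′≼v)))) (faithful ax′≼v))

    play-length : ∀ v → Faithful v → Proper-along v → length v ≢ t
    play-length v faithful proper refl = <⇒≱ deep (begin
      length v                                 ≡⟨ length-map proj₁ v ⟨
      length (history v)                       ≤⟨ proper-history-bound (allFin s) ∈-allFin
                                                    (faithful-history-proper v faithful proper) ⟩
      length (allFin s) * suc (length (allFin s))
                                               ≡⟨ cong (λ n → n * suc n) (length-tabulate {n = s} id) ⟩
      s * suc s                                ∎)
      where open ≤-Reasoning

    -- A child of `v` can be blocked only by `v` or a proper suffix of `v`, at most `t` words in
    -- all, and each blocks at most `d` children.
    not-all-children-blocked : ∀ v c → length v < t →
      ¬ (∀ i → ∃[ x ] Edge x ((c , i) ∷ v) × colour x ≡ colour ((c , i) ∷ v))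
    not-all-children-blocked v c short blocked = <⇒≱ enough-copies (begin
      N                               ≡⟨ length-tabulate child ⟨
      length (tabulate child)         ≤⟨ pigeonhole-AllPairs Blocks d (v ∷ suffixes v)
                                           children-distinct few-blocked
                                           (All.tabulate⁺ λ i → let x , e , eq = blocked i in
                                             x , ≺⇒∈suffixes (child i) (edge⇒≺ e) , e , eq , short) ⟩
      suc (length (suffixes v)) * d   ≡⟨ cong (λ n → suc n * d) (length-suffixes v) ⟩
      suc (length v) * d              ≤⟨ *-monoˡ-≤ d short ⟩
      t * d                           ∎)
      where
      open ≤-Reasoning
      child : Fin N → Word
      child i = (c , i) ∷ v
      Blocks : Word → Pred Word 0ℓ
      -- The length bound lets `decode-encode` carry the edge over to `graph`.
      Blocks x w = Edge x w × colour x ≡ colour w × length w ≤ t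
      children-distinct : AllPairs (λ w w′ → encode t w ≢ encode t w′) (tabulate child)
      children-distinct = AllPairs.tabulate⁺ λ {i} {j} i≢j eq → i≢j (child-injective
        (trans (sym (decode-encode t (child i) short))
          (trans (cong (decode t) eq) (decode-encode t (child j) short))))
        where
        child-injective : ∀ {i j} → child i ≡ child j → i ≡ j
        child-injective refl = refl
      few-blocked : ∀ x ws → AllPairs (λ w w′ → encode t w ≢ encode t w′) ws → All (Blocks x) ws →
        length ws ≤ d
      few-blocked x ws distinct blocks = subst (_≤ d) (length-map (encode t) ws)
        (few (encode t x) (map (encode t) ws) (AllPairs.map⁺ distinct) (All.map⁺ (All.map neighbour blocks)))
        where
        neighbour : ∀ {w} → Blocks x w →
          Graph._~_ graph (encode t x) (encode t w) × colour x ≡ colour w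
        neighbour {w} (e , eq , w≤t) = inj₁ (subst₂ Edge
          (sym (decode-encode t x (≤-trans (≼-length (≼-tail (proj₂ (edge⇒≺ e)))) w≤t)))
          (sym (decode-encode t w w≤t)) e) , eq

    -- Here `n` moves remain. Only children labelled with the actual colour of `v` keep the branch
    -- faithful. By induction none of them extends the play, so each is blocked up to double
    -- negation, and finitely many double negations combine.
    no-play : ∀ n v → length v + n ≡ t → Faithful v → ¬ Proper-along v
    no-play zero    v eq faithful proper =
      play-length v faithful proper (trans (sym (+-identityʳ _)) eq)
    no-play (suc n) v eq faithful proper =
      Fin.sequence (RawMonad.rawApplicative ¬¬-Monad) blocked
        (not-all-children-blocked v (colour v)
          (≤-trans (s≤s (m≤m+n (length v) n)) (≤-reflexive eq′)))
      where
      eq′ : suc (length v) + n ≡ t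
      eq′ = trans (sym (+-suc (length v) n)) eq
      blocked : ∀ i → ¬ ¬ (∃[ x ] Edge x ((colour v , i) ∷ v) × colour x ≡ colour ((colour v , i) ∷ v))
      blocked i unblocked = no-play n ((colour v , i) ∷ v) eq′
        (λ { ≼-refl → refl ; (≼-there p) → faithful p })
        (λ { ≼-refl e eq″ → unblocked (_ , e , eq″) ; (≼-there p) e → proper p e })

    contradictory : ⊥
    contradictory = no-play t [] refl (λ ()) λ { ≼-refl (_ , () , _) }

-- From the three parameters to monochromatic neighbours

length≤∣∣ : ∀ {n} (p : Subset n) {xs} → Unique xs → All (Subset._∈ p) xs → length xs ≤ ∣ p ∣
length≤∣∣ p []           _          = z≤n
length≤∣∣ p (x∉ ∷ uniq) (x∈p ∷ ps) = ≤-trans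
  (s≤s (length≤∣∣ (p Subset.- _) uniq
    (All.zipWith (λ (x≢y , y∈p) → Subset.x∈p∧x≢y⇒x∈p-y y∈p (x≢y ∘ sym)) (x∉ , ps))))
  (Subset.x∈p⇒∣p-x∣<∣p∣ x∈p)

∈-tabulate-does : ∀ {n} {P : Pred (Fin n) 0ℓ} (P? : ∀ i → Dec (P i)) i →
  i Subset.∈ Vec.tabulate (does ∘ P?) ⇔ P i
∈-tabulate-does P? i = mk⇔ to from
  where
  from = λ p → lookup⇒[]= i _ (trans (lookup∘tabulate (does ∘ P?) i) (dec-true (P? i) p))
  to : i Subset.∈ Vec.tabulate (does ∘ P?) → _
  to i∈ with P? i | trans (sym (lookup∘tabulate (does ∘ P?) i)) ([]=⇒lookup i∈)
  ... | yes p | _  = p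
  ... | no  _ | ()

¬¬-subset : ∀ {n} (P : Pred (Fin n) 0ℓ) → ¬ ¬ (∃[ p ] ∀ i → i Subset.∈ p ⇔ P i)
¬¬-subset P ¬p = Fin.sequence (RawMonad.rawApplicative ¬¬-Monad)
  (λ i → ¬¬-excluded-middle {A = P i})
  λ P? → ¬p (Vec.tabulate (does ∘ P?) , ∈-tabulate-does P?)

module _ (G : Graph) {k : ℕ} (f : Colouring G k) where
  open Graph G

  -- The neighbours of `u` in its colour lie in its component, which is obtained as a `Subset` only
  -- up to double negation; stability of `≤` absorbs this.
  defect⇒few : ∀ {d} → HasDefect G d f → FewMonochromaticNeighbours G d f
  defect⇒few {d} defect u ys uniq neighbour = decidable-stable (_ ≤? d) λ many →
    ¬¬-subset (Star (InducedAdj G λ v → f v ≡ f u) u) λ (C , ∈C⇔) →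
      let open module ∈C {v} = Equivalence (∈C⇔ v) in
      many (≤-trans
        (length≤∣∣ (neighbours u ∩ C) uniq
          (All.map (λ (u~y , fu≡fy) → Subset.x∈p∩q⁺
            ( Equivalence.from (∈-tabulate-does (u ~?_) _) u~y
            , from ((refl , sym fu≡fy , u~y) ◅ ε))) neighbour))
        (defect C (f u , u , refl , ∈C⇔) u (from ε)))

  clustering⇒defect : ∀ {c} → HasClustering G c f → HasDefect G c f
  clustering⇒defect clustering C component u _ =
    ≤-trans (Subset.∣p∩q∣≤∣q∣ (neighbours u) C) (clustering C component)

  proper⇒few : Proper G f → FewMonochromaticNeighbours G 0 f
  proper⇒few proper u []       _ _                     = z≤n
  proper⇒few proper u (y ∷ _) _ ((u~y , fu≡fy) ∷ _) = ⊥-elim (proper u y u~y fu≡fy)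

-- Minima and circumference up to double negation

¬¬-minimum : (P : Pred ℕ p) → ∀ {m} → P m → ¬ ¬ (∃[ n ] IsMinimum P n)
¬¬-minimum P {m} Pm none = none-below (suc m) m ≤-refl Pm
  where
  none-below : ∀ b n → n < b → ¬ P n
  none-below (suc b) n (s≤s n≤b) Pn = none (n , Pn , λ m Pm → ≮⇒≥ λ m<n →
    none-below b m (<-≤-trans m<n n≤b) Pm)

-- Descend from `k`, asking at each length whether a cycle attains it. On reaching 2 the graph is a
-- forest, of circumference 2 by convention.
¬¬-circumference : (G : Graph) → ∀ {k} → 2 ≤ k → (∀ ℓ → HasCycle G ℓ → ℓ ≤ k) →
  ¬ ¬ (∃[ c ] IsCircumference G c × c ≤ k)
¬¬-circumference G {k} 2≤k bound none with m≤n⇒m<n∨m≡n 2≤k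
... | inj₂ refl = none (2 , inj₂ (forest , refl) , ≤-refl)
  where
  forest : Forest G
  forest ℓ h@(_ , refl , _) = 1+n≰n (≤-trans (s≤s (s≤s (s≤s z≤n))) (bound ℓ h))
... | inj₁ (s≤s {n = k′} 2≤k′) = ¬¬-excluded-middle {A = HasCycle G k} λ where
  (yes cycle)   → none (k , inj₁ (cycle , bound) , ≤-refl)
  (no no-cycle) → ¬¬-circumference G 2≤k′
    (λ ℓ h → s≤s⁻¹ (≤∧≢⇒< (bound ℓ h) λ { refl → no-cycle h }))
    λ (c , circ , c≤k′) → none (c , circ , m≤n⇒m≤1+n c≤k′)

-- The lower bound

no-uniform-colouring : ∀ k n d → 2 ≤ k → 2 ^ (2 + n * suc n) ≤ k →
  ¬ (∀ G → TriangleFreeWithCircumference≤ k G →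
     ¬ ¬ (Σ[ f ∈ Colouring G n ] FewMonochromaticNeighbours G d f))
no-uniform-colouring k n d 2≤k large colourable =
  ¬¬-circumference graph 2≤k (λ ℓ h → <⇒≤ (<-≤-trans (graph-cycle-length ℓ h) large)) λ circ →
  colourable graph (graph-triangle-free , circ) λ (f , few) →
  contradictory ≤-refl ≤-refl f few
  where
  -- The least depth beyond the game bound, and the fewest copies exceeding `t * d`. The cycle bound
  -- `2 ^ suc t` does not involve `d`, so one `k` serves every defect.
  t = suc (n * suc n)
  open GameTree n (suc (t * d)) t

-- The right side is the exponent of 2 in `_≥_√log_` for `½`, whose denominator gives the factor 2.
-- With no colours the inequality would fail, hence `suc n`.
exponent-bound : ∀ n → 2 + suc n * (2 + n) ≤ (2 * suc n) ^ 2
exponent-bound n = ≤-trans (m≤m+n _ (3 * (n * n) + 5 * n)) (≤-reflexive (identity n))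
  where
  identity : ∀ n → 2 + suc n * (2 + n) + (3 * (n * n) + 5 * n) ≡ (2 * suc n) * ((2 * suc n) * 1)
  identity = solve-∀

≥½√log : ∀ {k n d} → 4 ≤ k →
  (∀ G → TriangleFreeWithCircumference≤ k G →
    ¬ ¬ (Σ[ f ∈ Colouring G n ] FewMonochromaticNeighbours G d f)) →
  n ≥ ½ √log k
≥½√log {k} {n} {d} 4≤k colourable = decidable-stable (_ ≤? _) λ small →
  no-uniform-colouring k n d (≤-trans (s≤s (s≤s z≤n)) 4≤k)
    (large n (subst (2 ^ ((2 * n) ^ 2) ≤_) (*-identityʳ k) (<⇒≤ (≰⇒> small))))
    colourable
  where
  large : ∀ n → 2 ^ ((2 * n) ^ 2) ≤ k → 2 ^ (2 + n * suc n) ≤ k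
  -- With no colours `2 ^ 2 ≤ k` is required, whence the threshold 4.
  large zero    _ = 4≤k
  large (suc n)   = ≤-trans (^-monoʳ-≤ 2 (exponent-bound n))

corollary12 : Σ[ c ∈ ℚ ] Positive c × (∃[ k₀ ] ∀ (k : ℕ) → k₀ ≤ k →
    (IsChromaticNumber (TriangleFreeWithCircumference≤ k) AtLeast c √log k)
    × (IsDefectiveChromaticNumber (TriangleFreeWithCircumference≤ k) AtLeast c √log k)
    × (IsClusteredChromaticNumber (TriangleFreeWithCircumference≤ k) AtLeast c √log k))
corollary12 = ½ , _ , 4 , λ k 4≤k →
  ( (λ n (_ , maximal) → ≥½√log {d = 0} 4≤k λ G G∈ none →
      -- Maximality of `n` concerns exact chromatic numbers, so `G` first needs one; the identity
      -- colouring is the proper colouring to start from.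
      ¬¬-minimum (λ m → Σ[ f ∈ Colouring G m ] Proper G f)
        (id , λ { u v u~v refl → Graph.~-irrefl G refl u~v })
        λ (m , isχ@((f , proper) , _)) →
          let m≤n = maximal m (G , G∈ , isχ) in
          none ( (λ v → Fin.inject≤ (f v) m≤n)
               , proper⇒few G _ λ u v u~v eq →
                   proper u v u~v (Fin.inject≤-injective m≤n m≤n _ _ eq)))
  , (λ n ((d , colourable) , _) → ≥½√log {d = d} 4≤k λ G G∈ none →
      let f , defect = colourable G G∈ in none (f , defect⇒few G f defect))
  , (λ n ((c , colourable) , _) → ≥½√log {d = c} 4≤k λ G G∈ none →
      let f , clustering = colourable G G∈ in
      none (f , defect⇒few G f (clustering⇒defect G f clustering)))
  )
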